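{- For any graph $G$ on $n$ vertices with maximum degree $\Delta$, $$HG(G) \leq 1+\frac{3n}{4}+\frac{\Delta^2}{4n}.$$ In particular, for every $\varepsilon>0$ there exist $\zeta=\zeta(\varepsilon)>0$, independent of $n$, and $n_0=n_0(\varepsilon)$ such that for every $n\ge n_0$ and every graph $G$ on $n$ vertices with maximum degree $\Delta(G)\leq (1-\varepsilon)n$, one has $HG(G)\leq (1-\zeta)n$.
   Context: Graphs are finite and simple, with at least one vertex. Let $G$ be a graph on $n$ vertices and let $k\ge 1$ be an integer. A $k$-coloring of $G$ is an arbitrary (not necessarily proper) map $c:V(G)\to\{1,\ldots,k\}$ (hat colors). A guessing strategy $\mathcal{S}$ with $k$ colors is a deterministic rule assigning to each vertex $v$ a function that takes the colors $(c(w))_{w\in N(v)}$ of the neighbors of $v$ (not including $v$ itself) and outputs a guess in $\{1,\ldots,k\}$. Vertex $v$ guesses correctly in $c$ if its guess equals $c(v)$. The strategy is winning if for every $k$-coloring $c$ at least one vertex guesses correctly. The hat guessing number $HG(G)$ is the largest $k$ for which a winning guessing strategy with $k$ colors exists. -}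

module Defs where

open import Data.Fin using (Fin; zero; suc)
open import Data.Fin.Properties using (any?) renaming (_≟_ to _≟ᶠ_)
open import Data.List using (List; length; filter; allFin)
import Data.List as List
open import Data.List.Extrema.Nat using (max)
import Data.List.Relation.Unary.All as All
open All using (All; []; _∷_)
open import Data.List.Relation.Unary.All.Properties using (all-filter)
open import Data.Nat using (ℕ; zero; suc; _+_; _*_; _^_; _≤_; z≤n; s≤s; NonZero)
open import Data.Nat.Properties
  using ( ≤-refl; ≤-reflexive; ≤-trans; ≤-pred; ≤∧≢⇒<; +-mono-≤; *-monoˡ-≤; m≤m+n; m≤n+m
        ; *-comm; *-cancelʳ-≤; m^n≢0; +-*-semiring; module ≤-Reasoning )
open import Data.Product using (∃; _×_; _,_; proj₁; proj₂)
open import Data.Integer using () renaming (+_ to pos)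
open import Data.Rational using (ℚ; _/_)
open import Data.Vec using (Vec; []; _∷_; fromList; lookup; _[_]≔_)
import Data.Vec as Vec
open import Data.Vec.Properties using (lookup∘updateAt′)
open import Function using (_∘_)
open import Level using (0ℓ)
open import Relation.Binary using (Rel; Decidable; Symmetric; Irreflexive)
open import Relation.Binary.PropositionalEquality
  using (_≡_; _≗_; refl; sym; trans; cong; cong₂)
open import Relation.Nullary using (Dec; yes; no; ¬_; ¬?)
open import Relation.Nullary.Decidable using (decidable-stable; map′)
open import Algebra.Properties.Semiring.Sum +-*-semiring
  using (sum; sum-syntax; sum-cong-≗; ∑-comm; *-distribʳ-sum)

record Graph (n : ℕ) : Set₁ where
  infix 4 _~_ _~?_
  field
    _~_      : Rel (Fin n) 0ℓ
    _~?_     : Decidable _~_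
    ~-sym    : Symmetric _~_
    ~-irrefl : Irreflexive _≡_ _~_

module _ {n : ℕ} (G : Graph n) where
  open Graph G

  neighbours : Fin n → List (Fin n)
  neighbours v = filter (v ~?_) (allFin n)

  degree : Fin n → ℕ
  degree v = length (neighbours v)

  maxDegree : ℕ
  maxDegree = max 0 (List.map degree (allFin n))

Coloring : ℕ → ℕ → Set
Coloring n k = Fin n → Fin k

module _ {n : ℕ} (G : Graph n) where

  -- The colours that v sees, listed in increasing order of the neighbours.
  -- Vectors, rather than functions on the neighbourhood, make every guess
  -- depend on the values of the colouring only, without function extensionality.
  view : ∀ {k} → Coloring n k → (v : Fin n) → Vec (Fin k) (degree G v)
  view c v = Vec.map c (fromList (neighbours G v))

  Strategy : ℕ → Set
  Strategy k = (v : Fin n) → Vec (Fin k) (degree G v) → Fin k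

  Winning : ∀ {k} → Strategy k → Set
  Winning {k} S = (c : Coloring n k) → ∃ λ v → S v (view c v) ≡ c v

  HasWinningStrategy : ℕ → Set
  HasWinningStrategy k = ∃ λ (S : Strategy k) → Winning S

  record IsHatGuessingNumber (h : ℕ) : Set where
    field
      positive : 1 ≤ h
      attained : HasWinningStrategy h
      largest  : ∀ k → 1 ≤ k → HasWinningStrategy k → k ≤ h

-- A largest k exists: having a winning strategy is decidable, because there are
-- finitely many strategies and colourings up to pointwise equality, and a winning
-- strategy with k colours forces k ≤ n, because each vertex guesses correctly in
-- exactly one k-th of all colourings.

module Existence where

  Searchable : (A : Set) → Rel A 0ℓ → Set₁
  Searchable A _≈_ = (P : A → Set) → (∀ {x y} → x ≈ y → P x → P y) →
                     (∀ x → Dec (P x)) → Dec (∃ P)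

  cons : ∀ {n} {A : Fin (suc n) → Set} → A zero → (∀ i → A (suc i)) → ∀ i → A i
  cons a f zero    = a
  cons a f (suc i) = f i

  search-Π : ∀ n (A : Fin n → Set) (_≈_ : ∀ {i} → Rel (A i) 0ℓ) →
             (∀ {i} {x : A i} → x ≈ x) → (∀ i → Searchable (A i) _≈_) →
             Searchable (∀ i → A i) (λ f g → ∀ i → f i ≈ g i)
  search-Π zero A _≈_ rfl s P resp P? =
    map′ (λ p → _ , p) (λ (f , p) → resp (λ ()) p) (P? (λ ()))
  search-Π (suc n) A _≈_ rfl s P resp P? =
    map′ (λ (a , f , p) → cons a f , p)
         (λ (f , p) → f zero , f ∘ suc , resp (λ { zero → rfl ; (suc i) → rfl }) p)
         (s zero (λ a → ∃ λ f → P (cons a f))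
            (λ e (f , p) → f , resp (λ { zero → e ; (suc i) → rfl }) p)
            (λ a → search-Π n (A ∘ suc) _≈_ rfl (s ∘ suc) (P ∘ cons a)
                     (λ e → resp (λ { zero → rfl ; (suc i) → e i })) (P? ∘ cons a)))

  search-Fin : ∀ k → Searchable (Fin k) _≡_
  search-Fin k P resp P? = any? P?

  search-Vec→ : ∀ k m → Searchable (Vec (Fin k) m → Fin k) _≗_
  search-Vec→ k zero P resp P? =
    map′ (λ (b , p) → _ , p)
         (λ (f , p) → f [] , resp (λ { [] → refl }) p)
         (search-Fin k (λ b → P (λ _ → b)) (λ { refl p → p }) (λ b → P? (λ _ → b)))
  search-Vec→ k (suc m) P resp P? =
    map′ (λ (f , p) → uncons f , p)
         (λ (f , p) → (λ x xs → f (x ∷ xs)) , resp (λ { (x ∷ xs) → refl }) p)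
         (search-Π k (λ _ → Vec (Fin k) m → Fin k) _≗_ (λ _ → refl)
            (λ _ → search-Vec→ k m) (P ∘ uncons)
            (λ e → resp (λ { (x ∷ xs) → e x xs })) (P? ∘ uncons))
    where
    uncons : (Fin k → Vec (Fin k) m → Fin k) → Vec (Fin k) (suc m) → Fin k
    uncons f (x ∷ xs) = f x xs

  map-fromList-cong : ∀ {A B : Set} {f g : A → B} {xs : List A} →
                      All (λ x → f x ≡ g x) xs →
                      Vec.map f (fromList xs) ≡ Vec.map g (fromList xs)
  map-fromList-cong []       = refl
  map-fromList-cong (e ∷ es) = cong₂ _∷_ e (map-fromList-cong es)

  view-local : ∀ {n k} (G : Graph n) {c c′ : Coloring n k} v →
               (∀ w → Graph._~_ G v w → c w ≡ c′ w) → view G c v ≡ view G c′ v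
  view-local {n} G v e =
    map-fromList-cong (All.map (λ {w} → e w)
                        (all-filter (Graph._~?_ G v) (allFin n)))

  module _ {n : ℕ} (G : Graph n) (k : ℕ) where

    winning? : (S : Strategy G k) → Dec (Winning G S)
    winning? S with search-Π n (λ _ → Fin k) _≡_ refl (λ _ → search-Fin k)
                      (λ c → ¬ Right c) (λ e ¬r r → ¬r (resp (sym ∘ e) r)) (¬? ∘ right?)
      where
      Right : Coloring n k → Set
      Right c = ∃ λ v → S v (view G c v) ≡ c v
      right? : ∀ c → Dec (Right c)
      right? c = any? λ v → S v (view G c v) ≟ᶠ c v
      resp : ∀ {c c′} → (∀ i → c i ≡ c′ i) → Right c → Right c′
      resp e (v , p) =
        v , trans (cong (S v) (sym (view-local G v (λ w _ → e w)))) (trans p (e v))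
    ... | yes (c , ¬r) = no λ w → ¬r (w c)
    ... | no ¬bad = yes λ c → decidable-stable (any? λ v → S v (view G c v) ≟ᶠ c v)
                                (λ ¬r → ¬bad (c , ¬r))

    hasWinningStrategy? : Dec (HasWinningStrategy G k)
    hasWinningStrategy? =
      search-Π n (λ v → Vec (Fin k) (degree G v) → Fin k) _≗_ (λ _ → refl)
        (λ v → search-Vec→ k (degree G v)) (Winning G)
        (λ e w c → let (v , p) = w c in v , trans (sym (e v (view G c v))) p) winning?

  ∑Vec : ∀ {k} n → (Vec (Fin k) n → ℕ) → ℕ
  ∑Vec zero    f = f []
  ∑Vec (suc n) f = ∑[ i < _ ] ∑Vec n (f ∘ (i ∷_))

  ∑Vec-cong : ∀ {k} n {f g : Vec (Fin k) n → ℕ} → f ≗ g → ∑Vec n f ≡ ∑Vec n g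
  ∑Vec-cong zero    e = e []
  ∑Vec-cong {k} (suc n) e = sum-cong-≗ {k} λ i → ∑Vec-cong n (e ∘ (i ∷_))

  ∑Vec-comm : ∀ {k m} n (f : Fin m → Vec (Fin k) n → ℕ) →
              ∑[ i < m ] ∑Vec n (f i) ≡ ∑Vec n (λ c → ∑[ i < m ] f i c)
  ∑Vec-comm zero    f = refl
  ∑Vec-comm {k} {m} (suc n) f =
    trans (∑-comm {m} {k} (λ i j → ∑Vec n (f i ∘ (j ∷_))))
          (sum-cong-≗ {k} λ j → ∑Vec-comm n (λ i → f i ∘ (j ∷_)))

  sum-mono : ∀ {m} {f g : Fin m → ℕ} → (∀ i → f i ≤ g i) → sum f ≤ sum g
  sum-mono {zero}  e = z≤n
  sum-mono {suc m} e = +-mono-≤ (e zero) (sum-mono (e ∘ suc))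

  ∑Vec-mono : ∀ {k} n {f g : Vec (Fin k) n → ℕ} → (∀ c → f c ≤ g c) → ∑Vec n f ≤ ∑Vec n g
  ∑Vec-mono zero    e = e []
  ∑Vec-mono {k} (suc n) e = sum-mono {k} λ i → ∑Vec-mono n (e ∘ (i ∷_))

  sum-const : ∀ m x → ∑[ i < m ] x ≡ m * x
  sum-const zero    x = refl
  sum-const (suc m) x = cong (x +_) (sum-const m x)

  ∑Vec-1 : ∀ k n → ∑Vec {k} n (λ _ → 1) ≡ k ^ n
  ∑Vec-1 k zero    = refl
  ∑Vec-1 k (suc n) = trans (sum-cong-≗ {k} λ _ → ∑Vec-1 k n) (sum-const k (k ^ n))

  δ : ∀ {k} → Fin k → Fin k → ℕ
  δ zero    zero    = 1
  δ zero    (suc j) = 0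
  δ (suc i) zero    = 0
  δ (suc i) (suc j) = δ i j

  δ-refl : ∀ {k} (i : Fin k) → δ i i ≡ 1
  δ-refl zero    = refl
  δ-refl (suc i) = δ-refl i

  ∑δ : ∀ {k} (i : Fin k) → ∑[ j < k ] δ i j ≡ 1
  ∑δ {suc k} zero    = cong suc (trans (sum-const k 0) (*-comm k 0))
  ∑δ {suc k} (suc i) = ∑δ i

  hits : ∀ {k n} (F : Vec (Fin (suc k)) n → Fin (suc k)) (v : Fin n) →
         (∀ c x → F (c [ v ]≔ x) ≡ F c) →
         ∑Vec n (λ c → δ (F c) (lookup c v)) * suc k ≡ suc k ^ n
  hits {k} {suc n} F zero indep =
    trans (cong (_* suc k)
      (trans (∑Vec-comm n (λ i c → δ (F (i ∷ c)) i))
      (trans (∑Vec-cong n λ c → trans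
                (sum-cong-≗ {suc k} λ i → cong (λ a → δ a i) (indep (zero ∷ c) i))
                (∑δ (F (zero ∷ c))))
             (∑Vec-1 (suc k) n))))
      (*-comm (suc k ^ n) (suc k))
  hits {k} {suc n} F (suc v) indep =
    trans (*-distribʳ-sum {suc k} (suc k)
             (λ i → ∑Vec n (λ c → δ (F (i ∷ c)) (lookup c v))))
    (trans (sum-cong-≗ {suc k} λ i → hits (F ∘ (i ∷_)) v (λ c x → indep (i ∷ c) x))
           (sum-const (suc k) _))

  term≤sum : ∀ {m} (f : Fin m → ℕ) i → f i ≤ sum f
  term≤sum f zero    = m≤m+n _ _
  term≤sum f (suc i) = ≤-trans (term≤sum (f ∘ suc) i) (m≤n+m _ _)

  winning⇒k≤n : ∀ {n} (G : Graph n) k → HasWinningStrategy G k → k ≤ n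
  winning⇒k≤n G zero    _       = z≤n
  winning⇒k≤n {n} G (suc k) (S , w) = *-cancelʳ-≤ (suc k) n (suc k ^ n) {{m^n≢0 (suc k) n}} (begin
    suc k * suc k ^ n                                 ≡⟨ *-comm (suc k) _ ⟩
    suc k ^ n * suc k                                 ≡⟨ cong (_* suc k) (∑Vec-1 (suc k) n) ⟨
    ∑Vec n (λ _ → 1) * suc k                          ≤⟨ *-monoˡ-≤ (suc k) (∑Vec-mono n someone) ⟩
    ∑Vec n (λ c → ∑[ v < n ] hit v c) * suc k         ≡⟨ cong (_* suc k) (∑Vec-comm n hit) ⟨
    (∑[ v < n ] ∑Vec n (hit v)) * suc k               ≡⟨ *-distribʳ-sum {n} (suc k) (λ v → ∑Vec n (hit v)) ⟩
    ∑[ v < n ] (∑Vec n (hit v) * suc k)               ≡⟨ sum-cong-≗ {n} (λ v → hits (guess v) v (indep v)) ⟩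
    ∑[ v < n ] (suc k ^ n)                            ≡⟨ sum-const n _ ⟩
    n * suc k ^ n                                     ∎)
    where
    open ≤-Reasoning
    guess : Fin n → Vec (Fin (suc k)) n → Fin (suc k)
    guess v c = S v (view G (lookup c) v)
    hit : Fin n → Vec (Fin (suc k)) n → ℕ
    hit v c = δ (guess v c) (lookup c v)
    indep : ∀ v c x → guess v (c [ v ]≔ x) ≡ guess v c
    indep v c x = cong (S v) (view-local G v λ u v~u →
      lookup∘updateAt′ u v (λ u≡v → Graph.~-irrefl G (sym u≡v) v~u) c)
    someone : ∀ c → 1 ≤ ∑[ v < n ] hit v c
    someone c = let (v , p) = w (lookup c) in
      ≤-trans (≤-reflexive (sym (trans (cong (λ a → δ a (lookup c v)) p) (δ-refl (lookup c v)))))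
              (term≤sum (λ v → hit v c) v)

  winning-1 : ∀ {n} .{{_ : NonZero n}} (G : Graph n) → HasWinningStrategy G 1
  winning-1 {suc n} G = (λ _ _ → zero) , λ c → zero , unique (c zero)
    where
    unique : (i : Fin 1) → zero ≡ i
    unique zero = refl

  greatest : ∀ {P : ℕ → Set} → (∀ k → Dec (P k)) → P 1 → ∀ b → (∀ k → P k → k ≤ suc b) →
             ∃ λ h → 1 ≤ h × P h × (∀ k → P k → k ≤ h)
  greatest P? p₁ zero    bound = 1 , ≤-refl , p₁ , bound
  greatest P? p₁ (suc b) bound with P? (suc (suc b))
  ... | yes p = suc (suc b) , s≤s z≤n , p , bound
  ... | no ¬p = greatest P? p₁ b λ k pk →
    ≤-pred (≤∧≢⇒< (bound k pk) (λ { refl → ¬p pk }))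

open Existence using (hasWinningStrategy?; winning⇒k≤n; winning-1; greatest)

abstract
  hatGuessingNumber : ∀ {n} .{{_ : NonZero n}} (G : Graph n) → ∃ (IsHatGuessingNumber G)
  hatGuessingNumber {suc n} G =
    let (h , 1≤h , ph , ub) = greatest (hasWinningStrategy? G) (winning-1 G) n (winning⇒k≤n G)
    in h , record { positive = 1≤h ; attained = ph ; largest = λ k _ → ub k }

HG : ∀ {n} .{{_ : NonZero n}} → Graph n → ℕ
HG G = proj₁ (hatGuessingNumber G)

HG-isHatGuessingNumber : ∀ {n} .{{_ : NonZero n}} (G : Graph n) → IsHatGuessingNumber G (HG G)
HG-isHatGuessingNumber G = proj₂ (hatGuessingNumber G)

fromℕ : ℕ → ℚ
fromℕ m = pos m / 1

{-# OPTIONS --safe #-}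

-- For a colouring c let C be the set of vertices that guess correctly, X = |C|,
-- and for each vertex v let B v say that C contains a vertex u ≠ v not adjacent to v.
-- The truth of B v does not depend on the colour of v, so for uniformly random c
-- the events v ∈ C and B v are independent.  If the strategy wins, then X ≥ 1, hence
--   * 2 + #{ v ∈ C ∣ B v } ≤ 2 X:  for X = 1 no v ∈ C satisfies B v,
--     and for X ≥ 2 already 2 + X ≤ 2 X;
--   * n ≤ #{ v ∣ B v } + Δ + 1:  for u ∈ C, B v can only fail for v in the closed
--     neighbourhood of u.
-- Taking expectations, k · 2 + n ≤ 2 n + Δ + 1, that is 2 k ≤ n + Δ + 1.
-- Both parts follow; for the first use 2 n Δ ≤ n² + Δ².

module Submission where

open import Defs
open import Data.Nat as ℕ using (ℕ; zero; suc; NonZero; z≤n; s≤s)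
open import Data.Nat.Properties as ℕₚ using (m*n≢0)
open import Relation.Binary.PropositionalEquality
  using (_≡_; refl; sym; trans; cong; cong₂; subst; module ≡-Reasoning)

module Counting where

  open import Data.Fin using (Fin; zero; suc)
  open import Data.Fin.Properties using (_≟_)
  open import Data.List as List using (length; filter; tabulate)
  open import Data.List.Extrema.Nat using (xs≤max)
  open import Data.List.Membership.Propositional.Properties using (∈-map⁺; ∈-allFin)
  import Data.List.Relation.Unary.All as All
  open import Data.Nat using (_+_; _*_; _∸_; _^_; _≤_; _⊓_)
  open import Data.Nat.Properties hiding (_≟_)
  open import Data.Nat.Tactic.RingSolver using (solve-∀)
  open import Data.Product using (∃; _,_)
  open import Data.Vec using (Vec; _∷_; lookup; _[_]≔_)
  open import Data.Vec.Properties using (lookup∘updateAt′)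
  open import Function using (_∘_)
  open import Relation.Nullary using (Dec; yes; no; ¬_; contradiction; ¬?)
  open import Relation.Nullary.Decidable using (_×-dec_)
  open import Relation.Unary using (Pred; Decidable)
  open import Algebra.Properties.Semiring.Sum +-*-semiring
    using (sum; sum-syntax; sum-cong-≗; ∑-distrib-+; *-distribˡ-sum; *-distribʳ-sum)
  open Existence using
    ( ∑Vec; ∑Vec-cong; ∑Vec-comm; ∑Vec-mono; sum-mono; sum-const; term≤sum
    ; δ; δ-refl; ∑δ; hits; view-local )

  -- Sums over all colourings, and independence.

  ∑Vec-+ : ∀ {k} n (f g : Vec (Fin k) n → ℕ) →
           ∑Vec n (λ c → f c + g c) ≡ ∑Vec n f + ∑Vec n g
  ∑Vec-+ zero    f g = refl
  ∑Vec-+ {k} (suc n) f g =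
    trans (sum-cong-≗ {k} λ i → ∑Vec-+ n (f ∘ (i ∷_)) (g ∘ (i ∷_)))
          (∑-distrib-+ {k} (λ i → ∑Vec n (f ∘ (i ∷_))) (λ i → ∑Vec n (g ∘ (i ∷_))))

  ∑Vec-const : ∀ k n a → ∑Vec {k} n (λ _ → a) ≡ a * k ^ n
  ∑Vec-const k zero    a = sym (*-identityʳ a)
  ∑Vec-const k (suc n) a = begin
    ∑[ i < k ] ∑Vec {k} n (λ _ → a)  ≡⟨ sum-cong-≗ {k} (λ _ → ∑Vec-const k n a) ⟩
    ∑[ i < k ] (a * k ^ n)           ≡⟨ sum-const k (a * k ^ n) ⟩
    k * (a * k ^ n)                  ≡⟨ shuffle k a (k ^ n) ⟩
    a * (k * k ^ n)                  ∎
    where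
    open ≡-Reasoning
    shuffle : ∀ x y z → x * (y * z) ≡ y * (x * z)
    shuffle = solve-∀

  -- When only coordinate `v` varies, `g` and the guess `F` stay constant, and `F` matches exactly
  -- one of the `suc k` colours. For `g` an indicator this is independence of two events, cleared of
  -- denominators.
  hits-weighted : ∀ {k n} (F : Vec (Fin (suc k)) n → Fin (suc k))
                  (g : Vec (Fin (suc k)) n → ℕ) (v : Fin n) →
                  (∀ c x → F (c [ v ]≔ x) ≡ F c) → (∀ c x → g (c [ v ]≔ x) ≡ g c) →
                  ∑Vec n (λ c → g c * δ (F c) (lookup c v)) * suc k ≡ ∑Vec n g
  hits-weighted {k} {suc n} F g zero F-indep g-indep = begin
    (∑[ i < K ] ∑Vec n (λ c → g (i ∷ c) * δ (F (i ∷ c)) i)) * K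
      -- Moves the sum over the coordinate `v` innermost, where `collapse` evaluates it.
      ≡⟨ cong (_* K) (∑Vec-comm n (λ i c → g (i ∷ c) * δ (F (i ∷ c)) i)) ⟩
    ∑Vec n (λ c → ∑[ i < K ] (g (i ∷ c) * δ (F (i ∷ c)) i)) * K
      ≡⟨ cong (_* K) (∑Vec-cong n collapse) ⟩
    ∑Vec n g₀ * K
      ≡⟨ *-comm (∑Vec n g₀) K ⟩
    K * ∑Vec n g₀
      ≡⟨ sum-const K _ ⟨
    ∑[ i < K ] ∑Vec n g₀
      ≡⟨ sum-cong-≗ {K} (λ i → ∑Vec-cong n λ c → sym (g-indep (zero ∷ c) i)) ⟩
    ∑[ i < K ] ∑Vec n (λ c → g (i ∷ c)) ∎
    where
    open ≡-Reasoning
    K = suc k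
    g₀ : Vec (Fin K) n → ℕ
    g₀ c = g (zero ∷ c)
    collapse : ∀ c → ∑[ i < K ] (g (i ∷ c) * δ (F (i ∷ c)) i) ≡ g₀ c
    collapse c = begin
      ∑[ i < K ] (g (i ∷ c) * δ (F (i ∷ c)) i)
        ≡⟨ sum-cong-≗ {K} (λ i → cong₂ (λ a b → a * δ b i)
             (g-indep (zero ∷ c) i) (F-indep (zero ∷ c) i)) ⟩
      ∑[ i < K ] (g₀ c * δ (F (zero ∷ c)) i)
        ≡⟨ *-distribˡ-sum {K} (g₀ c) (δ (F (zero ∷ c))) ⟨
      g₀ c * (∑[ i < K ] δ (F (zero ∷ c)) i)
        ≡⟨ cong (g₀ c *_) (∑δ (F (zero ∷ c))) ⟩
      g₀ c * 1
        ≡⟨ *-identityʳ (g₀ c) ⟩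
      g₀ c ∎
  hits-weighted {k} {suc n} F g (suc v) F-indep g-indep =
    trans (*-distribʳ-sum {suc k} (suc k)
             (λ i → ∑Vec n (λ c → g (i ∷ c) * δ (F (i ∷ c)) (lookup c v))))
          (sum-cong-≗ {suc k} λ i → hits-weighted (F ∘ (i ∷_)) (g ∘ (i ∷_)) v
             (λ c → F-indep (i ∷ c)) (λ c → g-indep (i ∷ c)))

  -- Indicators.

  δ-≢ : ∀ {k} {i j : Fin k} → ¬ i ≡ j → δ i j ≡ 0
  δ-≢ {i = zero}  {zero}  i≢j = contradiction refl i≢j
  δ-≢ {i = zero}  {suc j} i≢j = refl
  δ-≢ {i = suc i} {zero}  i≢j = refl
  δ-≢ {i = suc i} {suc j} i≢j = δ-≢ (i≢j ∘ cong suc)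

  𝟙 : ∀ {p} {P : Set p} → Dec P → ℕ
  𝟙 (yes _) = 1
  𝟙 (no  _) = 0

  -- Turns the list length in `degree` into a sum. A general `f` lets the induction pass to
  -- `f ∘ suc`.
  length-filter-tabulate : ∀ {a p} {A : Set a} {P : Pred A p} (P? : Decidable P)
                           {n} (f : Fin n → A) →
                           length (filter P? (tabulate f)) ≡ ∑[ i < n ] 𝟙 (P? (f i))
  length-filter-tabulate P? {zero}  f = refl
  length-filter-tabulate P? {suc n} f with P? (f zero)
  ... | yes _ = cong suc (length-filter-tabulate P? (f ∘ suc))
  ... | no  _ = length-filter-tabulate P? (f ∘ suc)

  -- Closed neighbourhoods and their complements.

  module _ {n : ℕ} (G : Graph n) where
    open Graph G

    degree≤maxDegree : ∀ v → degree G v ≤ maxDegree G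
    degree≤maxDegree v =
      All.lookup (xs≤max 0 (List.map (degree G) (List.allFin n)))
                 (∈-map⁺ (degree G) (∈-allFin v))

    nonadjacent : Fin n → Fin n → ℕ
    nonadjacent u v = 𝟙 (¬? (u ≟ v) ×-dec ¬? (u ~? v))

    nonadjacent≤1 : ∀ u v → nonadjacent u v ≤ 1
    nonadjacent≤1 u v with u ≟ v | u ~? v
    ... | yes _ | _     = z≤n
    ... | no  _ | yes _ = z≤n
    ... | no  _ | no  _ = ≤-refl

    nonadjacent+δ≤1 : ∀ u v → nonadjacent u v + δ u v ≤ 1
    nonadjacent+δ≤1 u v with u ≟ v | u ~? v
    ... | yes refl | _     = ≤-reflexive (δ-refl u)
    ... | no  u≢v  | yes _ = ≤-trans (≤-reflexive (δ-≢ u≢v)) z≤n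
    ... | no  u≢v  | no  _ = ≤-reflexive (cong suc (δ-≢ u≢v))

    -- The vertices left out form the closed neighbourhood of `u`: `δ u v` accounts for `u` itself,
    -- `𝟙 (u ~? v)` for its neighbours.
    n≤∑nonadjacent : ∀ u → n ≤ (∑[ v < n ] nonadjacent u v) + suc (maxDegree G)
    n≤∑nonadjacent u = begin
      n
        ≡⟨ trans (sum-const n 1) (*-identityʳ n) ⟨
      ∑[ v < n ] 1
        ≤⟨ sum-mono {n} cover ⟩
      ∑[ v < n ] (nonadjacent u v + (δ u v + 𝟙 (u ~? v)))
        ≡⟨ ∑-distrib-+ {n} (nonadjacent u) (λ v → δ u v + 𝟙 (u ~? v)) ⟩
      (∑[ v < n ] nonadjacent u v) + (∑[ v < n ] (δ u v + 𝟙 (u ~? v)))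
        ≡⟨ cong (sum (nonadjacent u) +_) (∑-distrib-+ {n} (δ u) (λ v → 𝟙 (u ~? v))) ⟩
      (∑[ v < n ] nonadjacent u v) + ((∑[ v < n ] δ u v) + (∑[ v < n ] 𝟙 (u ~? v)))
        ≡⟨ cong (sum (nonadjacent u) +_)
             (cong₂ _+_ (∑δ u) (sym (length-filter-tabulate (u ~?_) (λ v → v)))) ⟩
      (∑[ v < n ] nonadjacent u v) + suc (degree G u)
        ≤⟨ +-monoʳ-≤ (sum (nonadjacent u)) (s≤s (degree≤maxDegree u)) ⟩
      (∑[ v < n ] nonadjacent u v) + suc (maxDegree G) ∎
      where
      open ≤-Reasoning
      cover : ∀ v → 1 ≤ nonadjacent u v + (δ u v + 𝟙 (u ~? v))
      cover v with u ≟ v | u ~? v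
      ... | yes refl | yes _ = m≤n+m 1 _
      ... | yes refl | no  _ = ≤-reflexive (sym (trans (+-identityʳ _) (δ-refl u)))
      ... | no  _    | yes _ = m≤n+m 1 _
      ... | no  _    | no  _ = m≤m+n 1 _

    -- Counting correct guesses of a fixed winning strategy.

    module _ {k : ℕ} (S : Strategy G (suc k)) (wins : Winning G S) where

      private
        K : ℕ
        K = suc k

        N : ℕ
        N = K ^ n

      guess : Fin n → Vec (Fin K) n → Fin K
      guess v c = S v (view G (lookup c) v)

      hit : Fin n → Vec (Fin K) n → ℕ
      hit v c = δ (guess v c) (lookup c v)

      correct : Vec (Fin K) n → ℕ
      correct c = ∑[ v < n ] hit v c

      correctNonadjacent : Fin n → Vec (Fin K) n → ℕ
      correctNonadjacent v c = ∑[ u < n ] (nonadjacent u v * hit u c)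

      -- Truncation by `1 ⊓_` turns the number of correct vertices other than `v` and not adjacent
      -- to `v` into the indicator that there is one.
      B : Fin n → Vec (Fin K) n → ℕ
      B v c = 1 ⊓ correctNonadjacent v c

      -- By irreflexivity the hypothesis also admits `u = v`: a vertex does not see its own colour.
      guess-indep : ∀ u v → ¬ u ~ v → ∀ c x → guess u (c [ v ]≔ x) ≡ guess u c
      guess-indep u v u≁v c x = cong (S u) (view-local G u λ w u~w →
        lookup∘updateAt′ w v (λ { refl → u≁v u~w }) c)

      -- If the weight of `u` is nonzero, `u` is neither `v` nor adjacent to it, so neither the
      -- guess nor the colour of `u` changes.
      B-indep : ∀ v c x → B v (c [ v ]≔ x) ≡ B v c
      B-indep v c x = cong (1 ⊓_) (sum-cong-≗ {n} unaffected)
        where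
        unaffected : ∀ u → nonadjacent u v * hit u (c [ v ]≔ x) ≡ nonadjacent u v * hit u c
        unaffected u with u ≟ v | u ~? v
        ... | yes _  | _       = refl
        ... | no  _  | yes _   = refl
        ... | no u≢v | no  u≁v = cong (1 *_)
          (cong₂ δ (guess-indep u v u≁v c x) (lookup∘updateAt′ u v u≢v c))

      -- Independence: within the event `B v`, the vertex `v` is correct in exactly one `K`-th of
      -- the colourings.
      ∑B*hit : ∀ v → ∑Vec n (λ c → B v c * hit v c) * K ≡ ∑Vec n (B v)
      ∑B*hit v = hits-weighted (guess v) (B v) v
        (guess-indep v v (~-irrefl refl)) (B-indep v)

      -- Linearity of expectation: each vertex is correct in one `K`-th of the `N` colourings.
      ∑correct : ∑Vec n correct * K ≡ n * N
      ∑correct = begin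
        ∑Vec n correct * K
          ≡⟨ cong (_* K) (∑Vec-comm n hit) ⟨
        (∑[ v < n ] ∑Vec n (hit v)) * K
          ≡⟨ *-distribʳ-sum {n} K (λ v → ∑Vec n (hit v)) ⟩
        ∑[ v < n ] (∑Vec n (hit v) * K)
          ≡⟨ sum-cong-≗ {n} (λ v → hits (guess v) v (guess-indep v v (~-irrefl refl))) ⟩
        ∑[ v < n ] N
          ≡⟨ sum-const n N ⟩
        n * N ∎
        where open ≡-Reasoning

      someHit : ∀ c → ∃ λ v → hit v c ≡ 1
      someHit c = let (v , p) = wins (lookup c) in
        v , trans (cong (λ a → δ a (lookup c v)) p) (δ-refl (lookup c v))

      -- The two terms on the left count disjoint sets of correct vertices, since `nonadjacent u v`
      -- vanishes at `u = v`.
      correctNonadjacent+hit≤correct : ∀ v c → correctNonadjacent v c + hit v c ≤ correct c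
      correctNonadjacent+hit≤correct v c = begin
        correctNonadjacent v c + hit v c
          ≡⟨ cong (correctNonadjacent v c +_)
               (trans (cong (_* hit v c) (δ-refl v)) (*-identityˡ (hit v c))) ⟨
        correctNonadjacent v c + δ v v * hit v c
          -- Writes `hit v c` as part of a sum over `u`, so that the two sums can be compared with
          -- `correct c` termwise.
          ≤⟨ +-monoʳ-≤ (correctNonadjacent v c) (term≤sum (λ u → δ u v * hit u c) v) ⟩
        correctNonadjacent v c + (∑[ u < n ] (δ u v * hit u c))
          ≡⟨ ∑-distrib-+ {n} (λ u → nonadjacent u v * hit u c) (λ u → δ u v * hit u c) ⟨
        ∑[ u < n ] (nonadjacent u v * hit u c + δ u v * hit u c)
          ≤⟨ sum-mono {n} (λ u → begin
               nonadjacent u v * hit u c + δ u v * hit u c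
                 ≡⟨ *-distribʳ-+ (hit u c) (nonadjacent u v) (δ u v) ⟨
               (nonadjacent u v + δ u v) * hit u c
                 ≤⟨ *-monoˡ-≤ (hit u c) (nonadjacent+δ≤1 u v) ⟩
               1 * hit u c
                 ≡⟨ *-identityˡ (hit u c) ⟩
               hit u c ∎) ⟩
        correct c ∎
        where open ≤-Reasoning

      2+∑B*hit≤2correct : ∀ c → 2 + (∑[ v < n ] (B v c * hit v c)) ≤ 2 * correct c
      2+∑B*hit≤2correct c = begin
        2 + (∑[ v < n ] (B v c * hit v c))
          -- `1 ⊓ (X ∸ 1)` is the indicator of `X ≥ 2`. It does not depend on `v`, so it factors out
          -- and leaves `X`.
          ≤⟨ +-monoʳ-≤ 2 (sum-mono {n} bound) ⟩
        2 + (∑[ v < n ] ((1 ⊓ (X ∸ 1)) * hit v c))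
          ≡⟨ cong (2 +_) (*-distribˡ-sum {n} (1 ⊓ (X ∸ 1)) (λ v → hit v c)) ⟨
        2 + (1 ⊓ (X ∸ 1)) * X
          ≤⟨ arith X (let (v , p) = someHit c in
               ≤-trans (≤-reflexive (sym p)) (term≤sum (λ v → hit v c) v)) ⟩
        2 * X ∎
        where
        open ≤-Reasoning
        X = correct c
        bound : ∀ v → B v c * hit v c ≤ (1 ⊓ (X ∸ 1)) * hit v c
        bound v with hit v c | correctNonadjacent+hit≤correct v c
        ... | zero  | _ = ≤-reflexive (trans (*-zeroʳ (B v c)) (sym (*-zeroʳ (1 ⊓ (X ∸ 1)))))
        -- Here `v` itself is correct, so at most `X ∸ 1` correct vertices can be nonadjacent to it.
        ... | suc h | p = *-monoˡ-≤ (suc h) (⊓-monoʳ-≤ 1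
          (m+n≤o⇒m≤o∸n Y (≤-trans (+-monoʳ-≤ Y (s≤s z≤n)) p)))
          where
          Y : ℕ
          Y = correctNonadjacent v c
        arith : ∀ x → 1 ≤ x → 2 + (1 ⊓ (x ∸ 1)) * x ≤ 2 * x
        arith (suc zero)    _ = ≤-refl
        arith (suc (suc x)) _ = begin
          2 + 1 * (2 + x)  ≤⟨ m≤m+n _ x ⟩
          2 + 1 * (2 + x) + x  ≡⟨ double x ⟩
          2 * (2 + x)      ∎
          where
          double : ∀ x → 2 + 1 * (2 + x) + x ≡ 2 * (2 + x)
          double = solve-∀

      n≤∑B : ∀ c → n ≤ (∑[ v < n ] B v c) + suc (maxDegree G)
      n≤∑B c with u , p ← someHit c =
        ≤-trans (n≤∑nonadjacent u) (+-monoˡ-≤ _ (sum-mono {n} λ v →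
          -- The correct vertex `u` witnesses `B v` for every `v` nonadjacent to it.
          ⊓-glb (nonadjacent≤1 u v) (begin
            nonadjacent u v            ≡⟨ *-identityʳ (nonadjacent u v) ⟨
            nonadjacent u v * 1        ≡⟨ cong (nonadjacent u v *_) p ⟨
            nonadjacent u v * hit u c  ≤⟨ term≤sum (λ u → nonadjacent u v * hit u c) u ⟩
            correctNonadjacent v c     ∎)))
        where open ≤-Reasoning

      -- Sums `2+∑B*hit≤2correct` over all colourings. The factor `K` then turns both kinds of hit
      -- count into totals free of the strategy's guesses at `v`, by `∑B*hit` and `∑correct`.
      ∑2+∑B≤2nN : 2 * N * K + ∑Vec n (λ c → ∑[ v < n ] B v c) ≤ 2 * (n * N)
      ∑2+∑B≤2nN = begin
        2 * N * K + ∑Vec n (λ c → ∑[ v < n ] B v c)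
          ≡⟨ cong₂ (λ a b → a * K + b) (∑Vec-const K n 2) (∑Vec-comm n B) ⟨
        ∑Vec n (λ _ → 2) * K + (∑[ v < n ] ∑Vec n (B v))
          ≡⟨ cong (∑Vec n (λ _ → 2) * K +_) (sum-cong-≗ {n} ∑B*hit) ⟨
        ∑Vec n (λ _ → 2) * K + (∑[ v < n ] (∑Vec n (B*hit v) * K))
          ≡⟨ cong (∑Vec n (λ _ → 2) * K +_) (*-distribʳ-sum {n} K (λ v → ∑Vec n (B*hit v))) ⟨
        ∑Vec n (λ _ → 2) * K + (∑[ v < n ] ∑Vec n (B*hit v)) * K
          ≡⟨ *-distribʳ-+ K (∑Vec n (λ _ → 2)) _ ⟨
        (∑Vec n (λ _ → 2) + (∑[ v < n ] ∑Vec n (B*hit v))) * K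
          ≡⟨ cong (λ a → (∑Vec n (λ _ → 2) + a) * K) (∑Vec-comm n B*hit) ⟩
        (∑Vec n (λ _ → 2) + ∑Vec n (λ c → ∑[ v < n ] B*hit v c)) * K
          ≡⟨ cong (_* K) (∑Vec-+ n (λ _ → 2) (λ c → ∑[ v < n ] B*hit v c)) ⟨
        ∑Vec n (λ c → 2 + (∑[ v < n ] B*hit v c)) * K
          ≤⟨ *-monoˡ-≤ K (∑Vec-mono n 2+∑B*hit≤2correct) ⟩
        ∑Vec n (λ c → 2 * correct c) * K
          ≡⟨ cong (_* K) (trans (∑Vec-cong n λ c → 2*≡+ (correct c)) (∑Vec-+ n correct correct)) ⟩
        (∑Vec n correct + ∑Vec n correct) * K
          ≡⟨ cong (_* K) (2*≡+ (∑Vec n correct)) ⟨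
        2 * ∑Vec n correct * K
          ≡⟨ trans (*-assoc 2 (∑Vec n correct) K) (cong (2 *_) ∑correct) ⟩
        2 * (n * N) ∎
        where
        open ≤-Reasoning
        B*hit : Fin n → Vec (Fin K) n → ℕ
        B*hit v c = B v c * hit v c
        2*≡+ : ∀ x → 2 * x ≡ x + x
        2*≡+ x = cong (x +_) (+-identityʳ x)

      nN≤∑B : n * N ≤ ∑Vec n (λ c → ∑[ v < n ] B v c) + suc (maxDegree G) * N
      nN≤∑B = begin
        n * N
          ≡⟨ ∑Vec-const K n n ⟨
        ∑Vec {K} n (λ _ → n)
          ≤⟨ ∑Vec-mono n n≤∑B ⟩
        ∑Vec n (λ c → (∑[ v < n ] B v c) + suc (maxDegree G))
          ≡⟨ ∑Vec-+ n (λ c → ∑[ v < n ] B v c) (λ _ → suc (maxDegree G)) ⟩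
        ∑Vec n (λ c → ∑[ v < n ] B v c) + ∑Vec n (λ _ → suc (maxDegree G))
          ≡⟨ cong (∑Vec n (λ c → ∑[ v < n ] B v c) +_) (∑Vec-const K n (suc (maxDegree G))) ⟩
        ∑Vec n (λ c → ∑[ v < n ] B v c) + suc (maxDegree G) * N ∎
        where open ≤-Reasoning

      2K≤n+Δ+1 : 2 * K ≤ n + suc (maxDegree G)
      2K≤n+Δ+1 = *-cancelʳ-≤ (2 * K) (n + D) N {{m^n≢0 K n}}
        -- Adding the two summed inequalities puts the total `b` of all `B v` on both sides, where
        -- it cancels. Division by the number `N` of colourings follows.
        (+-cancelʳ-≤ (n * N + b) (2 * K * N) ((n + D) * N) (begin
          2 * K * N + (n * N + b)        ≡⟨ shuffle₁ K N n b ⟩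
          2 * N * K + b + n * N          ≤⟨ +-mono-≤ ∑2+∑B≤2nN nN≤∑B ⟩
          2 * (n * N) + (b + D * N)      ≡⟨ shuffle₂ n N b D ⟩
          (n + D) * N + (n * N + b)      ∎))
        where
        open ≤-Reasoning
        D b : ℕ
        D = suc (maxDegree G)
        b = ∑Vec n (λ c → ∑[ v < n ] B v c)
        shuffle₁ : ∀ K N n b → 2 * K * N + (n * N + b) ≡ 2 * N * K + b + n * N
        shuffle₁ = solve-∀
        shuffle₂ : ∀ n N b D → 2 * (n * N) + (b + D * N) ≡ (n + D) * N + (n * N + b)
        shuffle₂ = solve-∀

  -- Bounds on the hat guessing number in natural numbers.

  2HG≤n+Δ+1 : ∀ n .{{_ : NonZero n}} (G : Graph n) → 2 * HG G ≤ n + suc (maxDegree G)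
  2HG≤n+Δ+1 n G with HG G | HG-isHatGuessingNumber G
  ... | zero  | _ = z≤n
  ... | suc h | isHG = let (S , wins) = IsHatGuessingNumber.attained isHG in 2K≤n+Δ+1 G S wins

  -- Induction replaces the square of `a - b`, as subtraction on naturals truncates: raising `a` and
  -- `b` by one adds `2 * (1 + a + b)` to both sides.
  am-gm : ∀ a b → 2 * (a * b) ≤ a * a + b * b
  am-gm zero    b       = z≤n
  am-gm (suc a) zero    = ≤-trans (≤-reflexive (cong (2 *_) (*-zeroʳ a))) z≤n
  am-gm (suc a) (suc b) = begin
    2 * (suc a * suc b)                  ≡⟨ expandˡ a b ⟩
    2 * (a * b) + 2 * (1 + a + b)        ≤⟨ +-monoˡ-≤ _ (am-gm a b) ⟩
    a * a + b * b + 2 * (1 + a + b)      ≡⟨ expandʳ a b ⟩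
    suc a * suc a + suc b * suc b        ∎
    where
    open ≤-Reasoning
    expandˡ : ∀ a b → 2 * (suc a * suc b) ≡ 2 * (a * b) + 2 * (1 + a + b)
    expandˡ = solve-∀
    expandʳ : ∀ a b → a * a + b * b + 2 * (1 + a + b) ≡ suc a * suc a + suc b * suc b
    expandʳ = solve-∀

  4nHG≤4n+3n²+Δ² : ∀ n .{{_ : NonZero n}} (G : Graph n) →
                   4 * n * HG G ≤ 4 * n + 3 * n * n + maxDegree G ^ 2
  4nHG≤4n+3n²+Δ² n G = begin
    4 * n * HG G                                  ≡⟨ shuffle₁ n (HG G) ⟩
    2 * n * (2 * HG G)                            ≤⟨ *-monoʳ-≤ (2 * n) (2HG≤n+Δ+1 n G) ⟩
    2 * n * (n + suc D)                           ≡⟨ shuffle₂ n D ⟩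
    2 * n + 2 * n * n + 2 * (n * D)               ≤⟨ +-monoʳ-≤ (2 * n + 2 * n * n) (am-gm n D) ⟩
    2 * n + 2 * n * n + (n * n + D * D)           ≤⟨ m≤m+n _ (2 * n) ⟩
    2 * n + 2 * n * n + (n * n + D * D) + 2 * n   ≡⟨ shuffle₃ n D ⟩
    4 * n + 3 * n * n + D ^ 2                     ∎
    where
    open ≤-Reasoning
    D : ℕ
    D = maxDegree G
    shuffle₁ : ∀ n h → 4 * n * h ≡ 2 * n * (2 * h)
    shuffle₁ = solve-∀
    shuffle₂ : ∀ n D → 2 * n * (n + suc D) ≡ 2 * n + 2 * n * n + 2 * (n * D)
    shuffle₂ = solve-∀
    shuffle₃ : ∀ n D → 2 * n + 2 * n * n + (n * n + D * D) + 2 * n ≡ 4 * n + 3 * n * n + D * (D * 1)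
    shuffle₃ = solve-∀

-- Transfer to the rationals.

open import Data.Integer as ℤ using (+_; +[1+_]; -[1+_]; +0; +<+; +≤+)
import Data.Integer.Properties as ℤₚ
open import Data.Rational
  using ( ℚ; mkℚ; 0ℚ; 1ℚ; ½; _+_; _-_; _*_; _/_; _≤_; _<_; *<*
        ; Positive; positive; toℚᵘ; ↧ₙ_ )
import Data.Rational.Properties as ℚₚ
open import Data.Rational.Solver using (module +-*-Solver)
import Data.Rational.Unnormalised as ℚᵘ
import Data.Rational.Unnormalised.Properties as ℚᵘₚ
open import Data.Product using (∃; _×_; _,_)

-- `fromℕ` normalises by a gcd and is stuck on a variable. The arithmetic laws are therefore checked
-- on unnormalised fractions with denominator 1.
toℚᵘ-fromℕ : ∀ a → toℚᵘ (fromℕ a) ℚᵘ.≃ ℚᵘ.mkℚᵘ (+ a) 0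
toℚᵘ-fromℕ a = ℚₚ.toℚᵘ-fromℚᵘ (ℚᵘ.mkℚᵘ (+ a) 0)

fromℕ-+ : ∀ a b → fromℕ (a ℕ.+ b) ≡ fromℕ a + fromℕ b
fromℕ-+ a b = ℚₚ.toℚᵘ-injective (begin
  toℚᵘ (fromℕ (a ℕ.+ b))                     ≈⟨ toℚᵘ-fromℕ (a ℕ.+ b) ⟩
  ℚᵘ.mkℚᵘ (+ (a ℕ.+ b)) 0                    ≈⟨ ℚᵘ.*≡* (cong (ℤ._* (+ 1))
    (cong₂ ℤ._+_ (ℤₚ.*-identityʳ (+ a)) (ℤₚ.*-identityʳ (+ b)))) ⟨
  ℚᵘ.mkℚᵘ (+ a) 0 ℚᵘ.+ ℚᵘ.mkℚᵘ (+ b) 0       ≈⟨ ℚᵘₚ.+-cong (toℚᵘ-fromℕ a) (toℚᵘ-fromℕ b) ⟨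
  toℚᵘ (fromℕ a) ℚᵘ.+ toℚᵘ (fromℕ b)         ≈⟨ ℚₚ.toℚᵘ-homo-+ (fromℕ a) (fromℕ b) ⟨
  toℚᵘ (fromℕ a + fromℕ b)                   ∎)
  where open ℚᵘₚ.≃-Reasoning

fromℕ-* : ∀ a b → fromℕ (a ℕ.* b) ≡ fromℕ a * fromℕ b
fromℕ-* a b = ℚₚ.toℚᵘ-injective (begin
  toℚᵘ (fromℕ (a ℕ.* b))                     ≈⟨ toℚᵘ-fromℕ (a ℕ.* b) ⟩
  ℚᵘ.mkℚᵘ (+ (a ℕ.* b)) 0                    ≈⟨ ℚᵘ.*≡* (cong (ℤ._* (+ 1)) (ℤₚ.pos-* a b)) ⟩
  ℚᵘ.mkℚᵘ (+ a) 0 ℚᵘ.* ℚᵘ.mkℚᵘ (+ b) 0       ≈⟨ ℚᵘₚ.*-cong (toℚᵘ-fromℕ a) (toℚᵘ-fromℕ b) ⟨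
  toℚᵘ (fromℕ a) ℚᵘ.* toℚᵘ (fromℕ b)         ≈⟨ ℚₚ.toℚᵘ-homo-* (fromℕ a) (fromℕ b) ⟨
  toℚᵘ (fromℕ a * fromℕ b)                   ∎)
  where open ℚᵘₚ.≃-Reasoning

fromℕ-mono-≤ : ∀ {a b} → a ℕ.≤ b → fromℕ a ≤ fromℕ b
fromℕ-mono-≤ {a} {b} a≤b = ℚₚ.toℚᵘ-cancel-≤ (begin
  toℚᵘ (fromℕ a)     ≃⟨ toℚᵘ-fromℕ a ⟩
  ℚᵘ.mkℚᵘ (+ a) 0    ≤⟨ ℚᵘ.*≤* (ℤₚ.*-monoʳ-≤-nonNeg (+ 1) (+≤+ a≤b)) ⟩
  ℚᵘ.mkℚᵘ (+ b) 0    ≃⟨ toℚᵘ-fromℕ b ⟨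
  toℚᵘ (fromℕ b)     ∎)
  where open ℚᵘₚ.≤-Reasoning

fromℕ-positive : ∀ n .{{_ : NonZero n}} → Positive (fromℕ n)
fromℕ-positive n = ℚₚ.normalize-pos n 1

/-*-cancel : ∀ a d .{{_ : NonZero d}} → (+ a) / d * fromℕ d ≡ fromℕ a
/-*-cancel a d@(suc d-1) = ℚₚ.toℚᵘ-injective (begin
  toℚᵘ ((+ a) / d * fromℕ d)                 ≈⟨ ℚₚ.toℚᵘ-homo-* ((+ a) / d) (fromℕ d) ⟩
  toℚᵘ ((+ a) / d) ℚᵘ.* toℚᵘ (fromℕ d)       ≈⟨ ℚᵘₚ.*-cong
    (ℚₚ.toℚᵘ-fromℚᵘ (ℚᵘ.mkℚᵘ (+ a) d-1)) (toℚᵘ-fromℕ d) ⟩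
  ℚᵘ.mkℚᵘ (+ a) d-1 ℚᵘ.* ℚᵘ.mkℚᵘ (+ d) 0     ≈⟨ ℚᵘ.*≡*
    (trans (ℤₚ.*-identityʳ (+ a ℤ.* + d))
           (cong (λ m → + a ℤ.* + m) (sym (ℕₚ.*-identityʳ d)))) ⟩
  ℚᵘ.mkℚᵘ (+ a) 0                            ≈⟨ toℚᵘ-fromℕ a ⟨
  toℚᵘ (fromℕ a)                             ∎)
  where open ℚᵘₚ.≃-Reasoning

-- The product is the numerator of `ε`, a positive integer. This gives an explicit threshold for
-- `n`.
1≤ε*denominator : ∀ ε → 0ℚ < ε → 1ℚ ≤ ε * fromℕ (↧ₙ ε)
1≤ε*denominator (mkℚ +0 _ _)       (*<* (+<+ ()))
1≤ε*denominator (mkℚ -[1+ _ ] _ _) (*<* ())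
1≤ε*denominator ε@(mkℚ +[1+ m ] d _) _ =
  subst (1ℚ ≤_)
        (trans (sym (/-*-cancel (suc m) (suc d))) (cong (_* fromℕ (suc d)) (ℚₚ.↥p/↧p≡p ε)))
        (fromℕ-mono-≤ {1} {suc m} (s≤s z≤n))

-- The two rational bounds.

HG≤1+3n/4+Δ²/4n : ∀ n .{{_ : NonZero n}} (G : Graph n) →
  fromℕ (HG G) ≤ 1ℚ + (+ (3 ℕ.* n)) / 4 + _/_ (+ (maxDegree G ℕ.^ 2)) (4 ℕ.* n) {{m*n≢0 4 n}}
-- Multiplication by `4n` clears every denominator and reduces the claim to the bound on naturals.
HG≤1+3n/4+Δ²/4n n G = ℚₚ.*-cancelˡ-≤-pos (fromℕ 4n) {{fromℕ-positive 4n}} (begin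
  fromℕ 4n * fromℕ (HG G)
    ≡⟨ fromℕ-* 4n (HG G) ⟨
  fromℕ (4n ℕ.* HG G)
    ≤⟨ fromℕ-mono-≤ (Counting.4nHG≤4n+3n²+Δ² n G) ⟩
  fromℕ (4n ℕ.+ 3 ℕ.* n ℕ.* n ℕ.+ D²)
    ≡⟨ fromℕ-+ (4n ℕ.+ 3 ℕ.* n ℕ.* n) D² ⟩
  fromℕ (4n ℕ.+ 3 ℕ.* n ℕ.* n) + fromℕ D²
    ≡⟨ cong (_+ fromℕ D²) (fromℕ-+ 4n (3 ℕ.* n ℕ.* n)) ⟩
  fromℕ 4n + fromℕ (3 ℕ.* n ℕ.* n) + fromℕ D²
    ≡⟨ cong₂ (λ x y → fromℕ 4n + x + y) 3n²≡ (sym (/-*-cancel D² 4n)) ⟩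
  fromℕ 4n + a * fromℕ 4n + b * fromℕ 4n
    ≡⟨ solve 3 (λ x a b → x :+ a :* x :+ b :* x := x :* (con 1ℚ :+ a :+ b)) refl (fromℕ 4n) a b ⟩
  fromℕ 4n * (1ℚ + a + b) ∎)
  where
  open ℚₚ.≤-Reasoning
  open +-*-Solver
  4n = 4 ℕ.* n
  D² = maxDegree G ℕ.^ 2
  instance
    4n≢0 : NonZero 4n
    4n≢0 = m*n≢0 4 n
  a b : ℚ
  a = (+ (3 ℕ.* n)) / 4
  b = (+ D²) / 4n
  3n²≡ : fromℕ (3 ℕ.* n ℕ.* n) ≡ a * fromℕ 4n
  3n²≡ = begin-equality
    fromℕ (3 ℕ.* n ℕ.* n)          ≡⟨ fromℕ-* (3 ℕ.* n) n ⟩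
    fromℕ (3 ℕ.* n) * fromℕ n      ≡⟨ cong (_* fromℕ n) (/-*-cancel (3 ℕ.* n) 4) ⟨
    a * fromℕ 4 * fromℕ n          ≡⟨ ℚₚ.*-assoc a (fromℕ 4) (fromℕ n) ⟩
    a * (fromℕ 4 * fromℕ n)        ≡⟨ cong (a *_) (fromℕ-* 4 n) ⟨
    a * fromℕ 4n                   ∎

-- From `2HG≤n+Δ+1`, twice `HG G` is at most `(2 - ε) n + 1`. Since `ε n ≥ 2`, the 1 costs at most
-- `ε n / 2`, half of the gain; halving leaves `ε / 4`.
HG≤[1-ε/4]n : ∀ ε → 0ℚ < ε → ∀ n .{{_ : NonZero n}} → 2 ℕ.* ↧ₙ ε ℕ.≤ n → (G : Graph n) →
  fromℕ (maxDegree G) ≤ (1ℚ - ε) * fromℕ n → fromℕ (HG G) ≤ (1ℚ - ½ * ½ * ε) * fromℕ n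
HG≤[1-ε/4]n ε 0<ε n n₀≤n G Δ≤[1-ε]n =
  ℚₚ.*-cancelˡ-≤-pos (two * two) (begin
  two * two * H
    ≡⟨ ℚₚ.*-assoc two two H ⟩
  two * (two * H)
    ≡⟨ cong (two *_) (fromℕ-* 2 (HG G)) ⟨
  two * fromℕ (2 ℕ.* HG G)
    ≤⟨ ℚₚ.*-monoˡ-≤-nonNeg two (fromℕ-mono-≤ (Counting.2HG≤n+Δ+1 n G)) ⟩
  two * fromℕ (n ℕ.+ suc (maxDegree G))
    ≡⟨ cong (two *_) (trans (fromℕ-+ n (1 ℕ.+ maxDegree G))
                            (cong (λ x → N + x) (fromℕ-+ 1 (maxDegree G)))) ⟩
  two * (N + (1ℚ + fromℕ (maxDegree G)))
    ≤⟨ ℚₚ.*-monoˡ-≤-nonNeg two (ℚₚ.+-monoʳ-≤ N (ℚₚ.+-monoʳ-≤ 1ℚ Δ≤[1-ε]n)) ⟩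
  two * (N + (1ℚ + (1ℚ - ε) * N))
    ≡⟨ solve 2 (λ ε N → con two :* (N :+ (con 1ℚ :+ (con 1ℚ :- ε) :* N))
         := con two :* (N :+ (con 1ℚ :- ε) :* N) :+ con two) refl ε N ⟩
  two * (N + (1ℚ - ε) * N) + two
    -- The second factor `two` has doubled the stray 1, so that `2≤εn` absorbs it without fractions.
    ≤⟨ ℚₚ.+-monoʳ-≤ (two * (N + (1ℚ - ε) * N)) 2≤εn ⟩
  two * (N + (1ℚ - ε) * N) + ε * N
    ≡⟨ solve 2 (λ ε N → con two :* (N :+ (con 1ℚ :- ε) :* N) :+ ε :* N
         := con two :* con two :* ((con 1ℚ :- con ½ :* con ½ :* ε) :* N)) refl ε N ⟩
  two * two * ((1ℚ - ½ * ½ * ε) * N) ∎)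
  where
  open ℚₚ.≤-Reasoning
  open +-*-Solver
  two H N : ℚ
  two = fromℕ 2
  H = fromℕ (HG G)
  N = fromℕ n
  2≤εn : two ≤ ε * N
  2≤εn = begin
    two                          ≤⟨ ℚₚ.*-monoˡ-≤-nonNeg two (1≤ε*denominator ε 0<ε) ⟩
    two * (ε * fromℕ (↧ₙ ε))     ≡⟨ solve 3 (λ t ε q → t :* (ε :* q) := ε :* (t :* q))
                                      refl two ε (fromℕ (↧ₙ ε)) ⟩
    ε * (two * fromℕ (↧ₙ ε))     ≡⟨ cong (ε *_) (fromℕ-* 2 (↧ₙ ε)) ⟨
    ε * fromℕ (2 ℕ.* ↧ₙ ε)       ≤⟨ ℚₚ.*-monoˡ-≤-nonNeg ε
                                      {{ℚₚ.pos⇒nonNeg ε {{positive 0<ε}}}} (fromℕ-mono-≤ n₀≤n) ⟩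
    ε * N                        ∎

corollary2 : (∀ (n : ℕ) .{{_ : NonZero n}} (G : Graph n) →
    fromℕ (HG G) ≤ 1ℚ + (+ (3 ℕ.* n)) / 4 + _/_ (+ (maxDegree G ℕ.^ 2)) (4 ℕ.* n) {{m*n≢0 4 n}})
    ×
    (∀ (ε : ℚ) → 0ℚ < ε →
    ∃ λ (ζ : ℚ) → 0ℚ < ζ × (∃ λ (n₀ : ℕ) →
    ∀ (n : ℕ) .{{_ : NonZero n}} → n₀ ℕ.≤ n → (G : Graph n) →
    fromℕ (maxDegree G) ≤ (1ℚ - ε) * fromℕ n →
    fromℕ (HG G) ≤ (1ℚ - ζ) * fromℕ n))
corollary2 = HG≤1+3n/4+Δ²/4n , λ ε 0<ε →
  ½ * ½ * ε ,
  -- The left side `½ * ½ * 0ℚ` evaluates to `0ℚ`.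
  ℚₚ.*-monoʳ-<-pos (½ * ½) 0<ε ,
  2 ℕ.* ↧ₙ ε , HG≤[1-ε/4]n ε 0<ε
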